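{- Let $\ell:K(H\times\mathrm{Id})\to H\widehat K$ be an abstract GSOS rule with $\ell$-interpretation $b:KC\to C$, let $V$ be an endofunctor, $F=K+V$, and let $e:V(H\times\mathrm{Id})\to H\widehat F$ be an $\ell$-rps. Then there is a unique $V$-algebra $s:VC\to C$ (the interpreted solution of $e$) such that $$s=c^{ -1}\cdot H[b,s]^\sharp\cdot e_C\cdot V\langle c,\mathrm{id}_C\rangle.$$ Moreover, $c^{ -1}\cdot H[b,s]^\sharp:H\widehat FC\to C$ is a completely iterative algebra for $H\widehat F$.
   Context: Let $\mathcal A$ be a category with binary products and coproducts, let $H:\mathcal A\to\mathcal A$ be a functor with a terminal coalgebra $c:C\to HC$ (an isomorphism by Lambek's lemma). For an endofunctor $G$ we assume every object $X$ has a free $G$-algebra $\varphi_X:G\widehat GX\to\widehat GX$ with universal morphism $\eta_X$, so $\widehat G$ is the free monad on $G$ with universal natural transformation $\kappa:G\to\widehat G$; for a $G$-algebra $a:GA\to A$, $a^\sharp:\widehat GA\to A$ is the unique $G$-algebra homomorphism with $a^\sharp\cdot\eta_A=\mathrm{id}_A$. An abstract GSOS rule for $K$ is a natural transformation $\ell:K(H\times\mathrm{Id})\to H\widehat K$; its interpretation is the unique $b:KC\to C$ with $c\cdot b=Hb^\sharp\cdot\ell_C\cdot K\langle c,\mathrm{id}_C\rangle$. An $\ell$-rps is a natural transformation $e:V(H\times\mathrm{Id})\to H\widehat F$ with $F=K+V$. A $G$-algebra $a:GA\to A$ is a completely iterative algebra if every $e:X\to GX+A$ has a unique $e^\dagger:X\to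 A$ with $e^\dagger=[a,\mathrm{id}_A]\cdot(Ge^\dagger+\mathrm{id}_A)\cdot e$. -}

module Defs where

open import Level using (Level; _⊔_; suc)
open import Data.Product using (∃!; _×_; _,_; proj₁; proj₂)
open import Relation.Binary.Structures using (IsEquivalence)
open import Relation.Binary.Bundles using (Setoid)
import Relation.Binary.Reasoning.Setoid as SetoidReasoning

-- Hom-sets are setoids, so every "unique morphism" below means unique up to _≈_.
record Category (o m q : Level) : Set (suc (o ⊔ m ⊔ q)) where
  infix  4 _≈_ _⇒_
  infixr 9 _∘_
  field
    Obj       : Set o
    _⇒_       : Obj → Obj → Set m
    _≈_       : ∀ {X Y} → X ⇒ Y → X ⇒ Y → Set q
    id        : ∀ {X} → X ⇒ X
    _∘_       : ∀ {X Y Z} → Y ⇒ Z → X ⇒ Y → X ⇒ Z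
    assoc     : ∀ {W X Y Z} {f : W ⇒ X} {g : X ⇒ Y} {h : Y ⇒ Z} → (h ∘ g) ∘ f ≈ h ∘ (g ∘ f)
    identityˡ : ∀ {X Y} {f : X ⇒ Y} → id ∘ f ≈ f
    identityʳ : ∀ {X Y} {f : X ⇒ Y} → f ∘ id ≈ f
    equiv     : ∀ {X Y} → IsEquivalence (_≈_ {X} {Y})
    ∘-resp-≈  : ∀ {X Y Z} {f h : Y ⇒ Z} {g i : X ⇒ Y} → f ≈ h → g ≈ i → f ∘ g ≈ h ∘ i

  hom-setoid : Obj → Obj → Setoid m q
  hom-setoid X Y = record { Carrier = X ⇒ Y ; _≈_ = _≈_ ; isEquivalence = equiv }

  module Equiv {X Y : Obj} = IsEquivalence (equiv {X} {Y})
  module HomReasoning {X Y : Obj} = SetoidReasoning (hom-setoid X Y)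

  ∘-resp-≈ˡ : ∀ {X Y Z} {f h : Y ⇒ Z} {g : X ⇒ Y} → f ≈ h → f ∘ g ≈ h ∘ g
  ∘-resp-≈ˡ p = ∘-resp-≈ p Equiv.refl

  ∘-resp-≈ʳ : ∀ {X Y Z} {f : Y ⇒ Z} {g i : X ⇒ Y} → g ≈ i → f ∘ g ≈ f ∘ i
  ∘-resp-≈ʳ p = ∘-resp-≈ Equiv.refl p

record Endofunctor {o m q : Level} (𝒜 : Category o m q) : Set (o ⊔ m ⊔ q) where
  open Category 𝒜
  field
    F₀           : Obj → Obj
    F₁           : ∀ {X Y} → X ⇒ Y → F₀ X ⇒ F₀ Y
    identity     : ∀ {X} → F₁ (id {X}) ≈ id
    homomorphism : ∀ {X Y Z} {f : X ⇒ Y} {g : Y ⇒ Z} → F₁ (g ∘ f) ≈ F₁ g ∘ F₁ f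
    F-resp-≈     : ∀ {X Y} {f g : X ⇒ Y} → f ≈ g → F₁ f ≈ F₁ g

open Endofunctor public using (F₀; F₁)

record NaturalTransformation {o m q : Level} {𝒜 : Category o m q} (F G : Endofunctor 𝒜) : Set (o ⊔ m ⊔ q) where
  open Category 𝒜
  field
    component : ∀ X → F₀ F X ⇒ F₀ G X
    commute   : ∀ {X Y} (f : X ⇒ Y) → component Y ∘ F₁ F f ≈ F₁ G f ∘ component X

open NaturalTransformation public using (component)

record BinaryProducts {o m q : Level} (𝒜 : Category o m q) : Set (o ⊔ m ⊔ q) where
  open Category 𝒜
  infixr 7 _×ₒ_
  field
    _×ₒ_     : Obj → Obj → Obj
    π₁       : ∀ {X Y} → X ×ₒ Y ⇒ X
    π₂       : ∀ {X Y} → X ×ₒ Y ⇒ Y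
    ⟨_,_⟩    : ∀ {X Y Z} → Z ⇒ X → Z ⇒ Y → Z ⇒ X ×ₒ Y
    project₁ : ∀ {X Y Z} {f : Z ⇒ X} {g : Z ⇒ Y} → π₁ ∘ ⟨ f , g ⟩ ≈ f
    project₂ : ∀ {X Y Z} {f : Z ⇒ X} {g : Z ⇒ Y} → π₂ ∘ ⟨ f , g ⟩ ≈ g
    unique   : ∀ {X Y Z} {f : Z ⇒ X} {g : Z ⇒ Y} {h : Z ⇒ X ×ₒ Y} → π₁ ∘ h ≈ f → π₂ ∘ h ≈ g → ⟨ f , g ⟩ ≈ h

  _×₁_ : ∀ {X X′ Y Y′} → X ⇒ X′ → Y ⇒ Y′ → X ×ₒ Y ⇒ X′ ×ₒ Y′
  f ×₁ g = ⟨ f ∘ π₁ , g ∘ π₂ ⟩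

record BinaryCoproducts {o m q : Level} (𝒜 : Category o m q) : Set (o ⊔ m ⊔ q) where
  open Category 𝒜
  infixr 6 _+ₒ_
  field
    _+ₒ_    : Obj → Obj → Obj
    i₁      : ∀ {X Y} → X ⇒ X +ₒ Y
    i₂      : ∀ {X Y} → Y ⇒ X +ₒ Y
    [_,_]   : ∀ {X Y Z} → X ⇒ Z → Y ⇒ Z → X +ₒ Y ⇒ Z
    inject₁ : ∀ {X Y Z} {f : X ⇒ Z} {g : Y ⇒ Z} → [ f , g ] ∘ i₁ ≈ f
    inject₂ : ∀ {X Y Z} {f : X ⇒ Z} {g : Y ⇒ Z} → [ f , g ] ∘ i₂ ≈ g
    unique  : ∀ {X Y Z} {f : X ⇒ Z} {g : Y ⇒ Z} {h : X +ₒ Y ⇒ Z} → h ∘ i₁ ≈ f → h ∘ i₂ ≈ g → [ f , g ] ≈ h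

  _+₁_ : ∀ {X X′ Y Y′} → X ⇒ X′ → Y ⇒ Y′ → X +ₒ Y ⇒ X′ +ₒ Y′
  f +₁ g = [ i₁ ∘ f , i₂ ∘ g ]

module _ {o m q : Level} {𝒜 : Category o m q} where
  open Category 𝒜
  open HomReasoning

  Id : Endofunctor 𝒜
  Id = record
    { F₀ = λ X → X
    ; F₁ = λ f → f
    ; identity = Equiv.refl
    ; homomorphism = Equiv.refl
    ; F-resp-≈ = λ p → p
    }

  infixr 9 _∘F_
  _∘F_ : Endofunctor 𝒜 → Endofunctor 𝒜 → Endofunctor 𝒜
  G ∘F F = record
    { F₀ = λ X → F₀ G (F₀ F X)
    ; F₁ = λ f → F₁ G (F₁ F f)
    ; identity = Equiv.trans (G.F-resp-≈ F.identity) G.identity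
    ; homomorphism = Equiv.trans (G.F-resp-≈ F.homomorphism) G.homomorphism
    ; F-resp-≈ = λ p → G.F-resp-≈ (F.F-resp-≈ p)
    }
    where
      module F = Endofunctor F
      module G = Endofunctor G

  productFunctor : BinaryProducts 𝒜 → Endofunctor 𝒜 → Endofunctor 𝒜 → Endofunctor 𝒜
  productFunctor P F G = record
    { F₀ = λ X → F₀ F X ×ₒ F₀ G X
    ; F₁ = λ f → F₁ F f ×₁ F₁ G f
    ; identity = unique (square F.identity) (square G.identity)
    ; homomorphism = unique
        (paste project₁ project₁ F.homomorphism)
        (paste project₂ project₂ G.homomorphism)
    ; F-resp-≈ = λ p → unique
        (Equiv.trans project₁ (∘-resp-≈ˡ (Equiv.sym (F.F-resp-≈ p))))
        (Equiv.trans project₂ (∘-resp-≈ˡ (Equiv.sym (G.F-resp-≈ p))))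
    }
    where
      module F = Endofunctor F
      module G = Endofunctor G
      open BinaryProducts P

      square : ∀ {X Y} {k : Y ⇒ Y} {p : X ⇒ Y} → k ≈ id → p ∘ id ≈ k ∘ p
      square k≈id = Equiv.trans identityʳ (Equiv.sym (Equiv.trans (∘-resp-≈ˡ k≈id) identityˡ))

      paste : ∀ {X Y Z X′ Y′ Z′} {u : X ⇒ Y} {v : Y ⇒ Z} {u′ : X′ ⇒ Y′} {v′ : Y′ ⇒ Z′} {w : X′ ⇒ Z′}
                {p : X ⇒ X′} {p′ : Y ⇒ Y′} {p″ : Z ⇒ Z′} →
              p″ ∘ v ≈ v′ ∘ p′ → p′ ∘ u ≈ u′ ∘ p → w ≈ v′ ∘ u′ → p″ ∘ (v ∘ u) ≈ w ∘ p
      paste {u = u} {v} {u′} {v′} {w} {p} {p′} {p″} sq₁ sq₂ w≈ = begin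
        p″ ∘ (v ∘ u)   ≈⟨ assoc ⟨
        (p″ ∘ v) ∘ u   ≈⟨ ∘-resp-≈ˡ sq₁ ⟩
        (v′ ∘ p′) ∘ u  ≈⟨ assoc ⟩
        v′ ∘ (p′ ∘ u)  ≈⟨ ∘-resp-≈ʳ sq₂ ⟩
        v′ ∘ (u′ ∘ p)  ≈⟨ assoc ⟨
        (v′ ∘ u′) ∘ p  ≈⟨ ∘-resp-≈ˡ w≈ ⟨
        w ∘ p          ∎

  coproductFunctor : BinaryCoproducts 𝒜 → Endofunctor 𝒜 → Endofunctor 𝒜 → Endofunctor 𝒜
  coproductFunctor S F G = record
    { F₀ = λ X → F₀ F X +ₒ F₀ G X
    ; F₁ = λ f → F₁ F f +₁ F₁ G f
    ; identity = unique (square F.identity) (square G.identity)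
    ; homomorphism = unique
        (paste inject₁ inject₁ F.homomorphism)
        (paste inject₂ inject₂ G.homomorphism)
    ; F-resp-≈ = λ p → unique
        (Equiv.trans inject₁ (∘-resp-≈ʳ (Equiv.sym (F.F-resp-≈ p))))
        (Equiv.trans inject₂ (∘-resp-≈ʳ (Equiv.sym (G.F-resp-≈ p))))
    }
    where
      module F = Endofunctor F
      module G = Endofunctor G
      open BinaryCoproducts S

      square : ∀ {X Y} {k : X ⇒ X} {i : X ⇒ Y} → k ≈ id → id ∘ i ≈ i ∘ k
      square k≈id = Equiv.trans identityˡ (Equiv.sym (Equiv.trans (∘-resp-≈ʳ k≈id) identityʳ))

      paste : ∀ {X Y Z X′ Y′ Z′} {u : X ⇒ Y} {v : Y ⇒ Z} {u′ : X′ ⇒ Y′} {v′ : Y′ ⇒ Z′} {w : X ⇒ Z}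
                {i : X ⇒ X′} {i′ : Y ⇒ Y′} {i″ : Z ⇒ Z′} →
              u′ ∘ i ≈ i′ ∘ u → v′ ∘ i′ ≈ i″ ∘ v → w ≈ v ∘ u → (v′ ∘ u′) ∘ i ≈ i″ ∘ w
      paste {u = u} {v} {u′} {v′} {w} {i} {i′} {i″} sq₁ sq₂ w≈ = begin
        (v′ ∘ u′) ∘ i  ≈⟨ assoc ⟩
        v′ ∘ (u′ ∘ i)  ≈⟨ ∘-resp-≈ʳ sq₁ ⟩
        v′ ∘ (i′ ∘ u)  ≈⟨ assoc ⟨
        (v′ ∘ i′) ∘ u  ≈⟨ ∘-resp-≈ˡ sq₂ ⟩
        (i″ ∘ v) ∘ u   ≈⟨ assoc ⟩
        i″ ∘ (v ∘ u)   ≈⟨ ∘-resp-≈ʳ w≈ ⟨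
        i″ ∘ w         ∎

record TerminalCoalgebra {o m q : Level} {𝒜 : Category o m q} (H : Endofunctor 𝒜) : Set (o ⊔ m ⊔ q) where
  open Category 𝒜
  open HomReasoning
  private module H = Endofunctor H
  field
    C        : Obj
    c        : C ⇒ F₀ H C
    terminal : ∀ {X} (x : X ⇒ F₀ H X) → ∃! _≈_ (λ (h : X ⇒ C) → c ∘ h ≈ F₁ H h ∘ x)

  -- Lambek's lemma: the coalgebra homomorphism (HC, Hc) → (C, c) is inverse to c.
  c⁻¹ : F₀ H C ⇒ C
  c⁻¹ = proj₁ (terminal (F₁ H c))

  c⁻¹-hom : c ∘ c⁻¹ ≈ F₁ H c⁻¹ ∘ F₁ H c
  c⁻¹-hom = proj₁ (proj₂ (terminal (F₁ H c)))

  c⁻¹∘c≈id : c⁻¹ ∘ c ≈ id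
  c⁻¹∘c≈id = Equiv.trans (Equiv.sym (unique endo)) (unique (Equiv.trans identityʳ (Equiv.sym (Equiv.trans (∘-resp-≈ˡ H.identity) identityˡ))))
    where
      unique : ∀ {h : C ⇒ C} → c ∘ h ≈ F₁ H h ∘ c → proj₁ (terminal c) ≈ h
      unique = proj₂ (proj₂ (terminal c))

      endo : c ∘ (c⁻¹ ∘ c) ≈ F₁ H (c⁻¹ ∘ c) ∘ c
      endo = begin
        c ∘ (c⁻¹ ∘ c)              ≈⟨ assoc ⟨
        (c ∘ c⁻¹) ∘ c              ≈⟨ ∘-resp-≈ˡ c⁻¹-hom ⟩
        (F₁ H c⁻¹ ∘ F₁ H c) ∘ c    ≈⟨ ∘-resp-≈ˡ H.homomorphism ⟨
        F₁ H (c⁻¹ ∘ c) ∘ c         ∎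

  c∘c⁻¹≈id : c ∘ c⁻¹ ≈ id
  c∘c⁻¹≈id = begin
    c ∘ c⁻¹              ≈⟨ c⁻¹-hom ⟩
    F₁ H c⁻¹ ∘ F₁ H c    ≈⟨ H.homomorphism ⟨
    F₁ H (c⁻¹ ∘ c)       ≈⟨ H.F-resp-≈ c⁻¹∘c≈id ⟩
    F₁ H id              ≈⟨ H.identity ⟩
    id                   ∎

record FreeAlgebras {o m q : Level} {𝒜 : Category o m q} (G : Endofunctor 𝒜) : Set (o ⊔ m ⊔ q) where
  open Category 𝒜
  open HomReasoning
  private module G = Endofunctor G
  field
    Ĝ    : Obj → Obj
    φ    : ∀ X → F₀ G (Ĝ X) ⇒ Ĝ X
    η    : ∀ X → X ⇒ Ĝ X
    free : ∀ {X A} (a : F₀ G A ⇒ A) (f : X ⇒ A) →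
           ∃! _≈_ (λ (h : Ĝ X ⇒ A) → (h ∘ φ X ≈ a ∘ F₁ G h) × (h ∘ η X ≈ f))

  ext : ∀ {X A} → F₀ G A ⇒ A → X ⇒ A → Ĝ X ⇒ A
  ext a f = proj₁ (free a f)

  ext-φ : ∀ {X A} (a : F₀ G A ⇒ A) (f : X ⇒ A) → ext a f ∘ φ X ≈ a ∘ F₁ G (ext a f)
  ext-φ a f = proj₁ (proj₁ (proj₂ (free a f)))

  ext-η : ∀ {X A} (a : F₀ G A ⇒ A) (f : X ⇒ A) → ext a f ∘ η X ≈ f
  ext-η a f = proj₂ (proj₁ (proj₂ (free a f)))

  ext-unique : ∀ {X A} {a : F₀ G A ⇒ A} {f : X ⇒ A} {h : Ĝ X ⇒ A} →
               h ∘ φ X ≈ a ∘ F₁ G h → h ∘ η X ≈ f → ext a f ≈ h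
  ext-unique {a = a} {f} p r = proj₂ (proj₂ (free a f)) (p , r)

  infix 10 _♯
  _♯ : ∀ {A} → F₀ G A ⇒ A → Ĝ A ⇒ A
  a ♯ = ext a id

  -- The functor part of the free monad: Ĝ f is the homomorphism extending η ∘ f.
  functor : Endofunctor 𝒜
  functor = record
    { F₀ = Ĝ
    ; F₁ = Ĝ₁
    ; identity = ext-unique
        (Equiv.trans identityˡ (Equiv.sym (Equiv.trans (∘-resp-≈ʳ G.identity) identityʳ)))
        (Equiv.trans identityˡ (Equiv.sym identityʳ))
    ; homomorphism = λ {X} {Y} {Z} {f} {g} → ext-unique (hom-φ f g) (hom-η f g)
    ; F-resp-≈ = λ {X} {Y} {f} {g} p → ext-unique
        (ext-φ (φ Y) (η Y ∘ g))
        (Equiv.trans (ext-η (φ Y) (η Y ∘ g)) (∘-resp-≈ʳ (Equiv.sym p)))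
    }
    where
      Ĝ₁ : ∀ {X Y} → X ⇒ Y → Ĝ X ⇒ Ĝ Y
      Ĝ₁ {X} {Y} f = ext (φ Y) (η Y ∘ f)

      hom-φ : ∀ {X Y Z} (f : X ⇒ Y) (g : Y ⇒ Z) → (Ĝ₁ g ∘ Ĝ₁ f) ∘ φ X ≈ φ Z ∘ F₁ G (Ĝ₁ g ∘ Ĝ₁ f)
      hom-φ {X} {Y} {Z} f g = begin
        (Ĝ₁ g ∘ Ĝ₁ f) ∘ φ X                  ≈⟨ assoc ⟩
        Ĝ₁ g ∘ (Ĝ₁ f ∘ φ X)                  ≈⟨ ∘-resp-≈ʳ (ext-φ (φ Y) (η Y ∘ f)) ⟩
        Ĝ₁ g ∘ (φ Y ∘ F₁ G (Ĝ₁ f))           ≈⟨ assoc ⟨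
        (Ĝ₁ g ∘ φ Y) ∘ F₁ G (Ĝ₁ f)           ≈⟨ ∘-resp-≈ˡ (ext-φ (φ Z) (η Z ∘ g)) ⟩
        (φ Z ∘ F₁ G (Ĝ₁ g)) ∘ F₁ G (Ĝ₁ f)    ≈⟨ assoc ⟩
        φ Z ∘ (F₁ G (Ĝ₁ g) ∘ F₁ G (Ĝ₁ f))    ≈⟨ ∘-resp-≈ʳ G.homomorphism ⟨
        φ Z ∘ F₁ G (Ĝ₁ g ∘ Ĝ₁ f)             ∎

      hom-η : ∀ {X Y Z} (f : X ⇒ Y) (g : Y ⇒ Z) → (Ĝ₁ g ∘ Ĝ₁ f) ∘ η X ≈ η Z ∘ (g ∘ f)
      hom-η {X} {Y} {Z} f g = begin
        (Ĝ₁ g ∘ Ĝ₁ f) ∘ η X    ≈⟨ assoc ⟩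
        Ĝ₁ g ∘ (Ĝ₁ f ∘ η X)    ≈⟨ ∘-resp-≈ʳ (ext-η (φ Y) (η Y ∘ f)) ⟩
        Ĝ₁ g ∘ (η Y ∘ f)       ≈⟨ assoc ⟨
        (Ĝ₁ g ∘ η Y) ∘ f       ≈⟨ ∘-resp-≈ˡ (ext-η (φ Z) (η Z ∘ g)) ⟩
        (η Z ∘ g) ∘ f          ≈⟨ assoc ⟩
        η Z ∘ (g ∘ f)          ∎

module _ {o m q : Level} {𝒜 : Category o m q} where
  open Category 𝒜

  IsCompletelyIterative : BinaryCoproducts 𝒜 → (G : Endofunctor 𝒜) {A : Obj} → F₀ G A ⇒ A → Set (o ⊔ m ⊔ q)
  IsCompletelyIterative S G {A} a =
    ∀ {X} (e : X ⇒ F₀ G X +ₒ A) → ∃! _≈_ (λ (e† : X ⇒ A) → e† ≈ [ a , id ] ∘ (F₁ G e† +₁ id) ∘ e)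
    where open BinaryCoproducts S

  GSOSRule : BinaryProducts 𝒜 → (H K : Endofunctor 𝒜) → FreeAlgebras K → Set (o ⊔ m ⊔ q)
  GSOSRule P H K K̂ = NaturalTransformation (K ∘F productFunctor P H Id) (H ∘F FreeAlgebras.functor K̂)

  -- Only the defining equation is required of b; it determines b up to _≈_.
  IsInterpretation : (P : BinaryProducts 𝒜) {H K : Endofunctor 𝒜} (T : TerminalCoalgebra H) (K̂ : FreeAlgebras K) →
                     GSOSRule P H K K̂ → F₀ K (TerminalCoalgebra.C T) ⇒ TerminalCoalgebra.C T → Set q
  IsInterpretation P {H} {K} T K̂ ℓ b = c ∘ b ≈ F₁ H (b ♯) ∘ component ℓ C ∘ F₁ K ⟨ c , id ⟩
    where
      open BinaryProducts P
      open TerminalCoalgebra T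
      open FreeAlgebras K̂

  -- The notion does not involve ℓ itself, only its functor K.
  RPS : BinaryProducts 𝒜 → (S : BinaryCoproducts 𝒜) (H K V : Endofunctor 𝒜) →
        FreeAlgebras (coproductFunctor S K V) → Set (o ⊔ m ⊔ q)
  RPS P S H K V F̂ = NaturalTransformation (V ∘F productFunctor P H Id) (H ∘F FreeAlgebras.functor F̂)

-- The rule ℓ and the recursive program scheme e together form an abstract GSOS rule for F = K + V, and the
-- interpreted solutions s of e correspond to the interpretations [b , s] of that rule, so it suffices
-- to study the interpretations of a single rule ℓ for F.  Every g : Y → HF̂Y extends along ℓ, by primitive
-- recursion, to a coalgebra ĝ : F̂Y → HF̂Y that makes the free algebra F̂Y an ℓ-bialgebra.  For an interpretation
-- b, the maps h : Y → C with c ∘ h = H(b♯ ∘ F̂h) ∘ g correspond to the coalgebra homomorphisms F̂Y → C, of which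
-- there is exactly one.  Taking g = Hη ∘ c gives existence and uniqueness of b, and encoding a
-- flat equation X → HF̂X + C as g : X + C → HF̂(X + C) gives complete iterativity.
{-# OPTIONS --safe #-}
module Submission where

open import Defs
open import Level using (Level)
open import Data.Product using (Σ; ∃!; _,_; proj₁; proj₂)

-- Rewriting composites, pairings and copairings

module CategoryProperties {o m q : Level} (𝒜 : Category o m q) where
  open Category 𝒜

  pullˡ : ∀ {W X Y Z} {f : Y ⇒ Z} {g : X ⇒ Y} {h : X ⇒ Z} {k : W ⇒ X} → f ∘ g ≈ h → f ∘ (g ∘ k) ≈ h ∘ k
  pullˡ p = Equiv.trans (Equiv.sym assoc) (∘-resp-≈ˡ p)

  pullʳ : ∀ {W X Y Z} {f : Y ⇒ Z} {g : X ⇒ Y} {h : W ⇒ Y} {k : W ⇒ X} → g ∘ k ≈ h → (f ∘ g) ∘ k ≈ f ∘ h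
  pullʳ p = Equiv.trans assoc (∘-resp-≈ʳ p)

  extendʳ : ∀ {W X X′ Y Z} {f : Y ⇒ Z} {g : X ⇒ Y} {f′ : X′ ⇒ Z} {g′ : X ⇒ X′} {k : W ⇒ X} →
            f ∘ g ≈ f′ ∘ g′ → f ∘ (g ∘ k) ≈ f′ ∘ (g′ ∘ k)
  extendʳ p = Equiv.trans (pullˡ p) assoc

  elimʳ : ∀ {X Y} {f : X ⇒ Y} {g : X ⇒ X} → g ≈ id → f ∘ g ≈ f
  elimʳ p = Equiv.trans (∘-resp-≈ʳ p) identityʳ

  module ProductProperties (P : BinaryProducts 𝒜) where
    open BinaryProducts P

    ⟨⟩-cong : ∀ {X Y Z} {f f′ : Z ⇒ X} {g g′ : Z ⇒ Y} → f ≈ f′ → g ≈ g′ → ⟨ f , g ⟩ ≈ ⟨ f′ , g′ ⟩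
    ⟨⟩-cong p r = unique (Equiv.trans project₁ (Equiv.sym p)) (Equiv.trans project₂ (Equiv.sym r))

    ⟨⟩∘ : ∀ {W X Y Z} {f : Z ⇒ X} {g : Z ⇒ Y} {k : W ⇒ Z} → ⟨ f , g ⟩ ∘ k ≈ ⟨ f ∘ k , g ∘ k ⟩
    ⟨⟩∘ = Equiv.sym (unique (pullˡ project₁) (pullˡ project₂))

    ×₁∘⟨⟩ : ∀ {W X X′ Y Y′} {f : X ⇒ X′} {g : Y ⇒ Y′} {h : W ⇒ X} {k : W ⇒ Y} →
            (f ×₁ g) ∘ ⟨ h , k ⟩ ≈ ⟨ f ∘ h , g ∘ k ⟩
    ×₁∘⟨⟩ = Equiv.trans ⟨⟩∘ (⟨⟩-cong (pullʳ project₁) (pullʳ project₂))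

  module CoproductProperties (S : BinaryCoproducts 𝒜) where
    open BinaryCoproducts S

    []-cong : ∀ {X Y Z} {f f′ : X ⇒ Z} {g g′ : Y ⇒ Z} → f ≈ f′ → g ≈ g′ → [ f , g ] ≈ [ f′ , g′ ]
    []-cong p r = unique (Equiv.trans inject₁ (Equiv.sym p)) (Equiv.trans inject₂ (Equiv.sym r))

    ∘[] : ∀ {W X Y Z} {f : X ⇒ Z} {g : Y ⇒ Z} {k : Z ⇒ W} → k ∘ [ f , g ] ≈ [ k ∘ f , k ∘ g ]
    ∘[] = Equiv.sym (unique (pullʳ inject₁) (pullʳ inject₂))

    []∘+₁ : ∀ {X X′ Y Y′ Z} {f : X ⇒ X′} {g : Y ⇒ Y′} {h : X′ ⇒ Z} {k : Y′ ⇒ Z} →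
            [ h , k ] ∘ (f +₁ g) ≈ [ h ∘ f , k ∘ g ]
    []∘+₁ = Equiv.trans ∘[] ([]-cong (pullˡ inject₁) (pullˡ inject₂))

    jointly-epic : ∀ {X Y Z} {f g : X +ₒ Y ⇒ Z} → f ∘ i₁ ≈ g ∘ i₁ → f ∘ i₂ ≈ g ∘ i₂ → f ≈ g
    jointly-epic p r = Equiv.trans (Equiv.sym (unique p r)) (unique Equiv.refl Equiv.refl)

-- Functor images of commuting triangles and squares

module FunctorProperties {o m q : Level} {𝒜 : Category o m q} (G : Endofunctor 𝒜) where
  open Category 𝒜
  open Endofunctor G using (homomorphism; F-resp-≈)

  F-fuse : ∀ {X Y Z} {f : X ⇒ Y} {g : Y ⇒ Z} {h : X ⇒ Z} → g ∘ f ≈ h → F₁ G g ∘ F₁ G f ≈ F₁ G h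
  F-fuse p = Equiv.trans (Equiv.sym homomorphism) (F-resp-≈ p)

  F-square : ∀ {X Y Y′ Z} {f : X ⇒ Y} {g : Y ⇒ Z} {f′ : X ⇒ Y′} {g′ : Y′ ⇒ Z} →
             g ∘ f ≈ g′ ∘ f′ → F₁ G g ∘ F₁ G f ≈ F₁ G g′ ∘ F₁ G f′
  F-square p = Equiv.trans (F-fuse p) homomorphism

-- Free algebras and the structure of the free monad

module FreeAlgebraProperties {o m q : Level} {𝒜 : Category o m q} {G : Endofunctor 𝒜} (Ĝ : FreeAlgebras G) where
  open Category 𝒜
  open HomReasoning
  open CategoryProperties 𝒜
  open FreeAlgebras Ĝ renaming (Ĝ to Ĝ₀)
  open FunctorProperties G
  private
    module G = Endofunctor G
    T = functor

  -- The multiplication of the free monad.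
  μ : ∀ X → Ĝ₀ (Ĝ₀ X) ⇒ Ĝ₀ X
  μ X = φ X ♯

  ext-cong : ∀ {X A} {a a′ : F₀ G A ⇒ A} {f f′ : X ⇒ A} → a ≈ a′ → f ≈ f′ → ext a f ≈ ext a′ f′
  ext-cong p r = ext-unique (Equiv.trans (ext-φ _ _) (∘-resp-≈ˡ (Equiv.sym p))) (Equiv.trans (ext-η _ _) (Equiv.sym r))

  ext-fusion : ∀ {X A B} {a : F₀ G A ⇒ A} {a′ : F₀ G B ⇒ B} {f : X ⇒ A} {k : A ⇒ B} →
               k ∘ a ≈ a′ ∘ F₁ G k → k ∘ ext a f ≈ ext a′ (k ∘ f)
  ext-fusion {a = a} {a′} {f} {k} k-hom = Equiv.sym (ext-unique φ-hom (pullʳ (ext-η a f)))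
    where
      φ-hom : (k ∘ ext a f) ∘ φ _ ≈ a′ ∘ F₁ G (k ∘ ext a f)
      φ-hom = begin
        (k ∘ ext a f) ∘ φ _             ≈⟨ pullʳ (ext-φ a f) ⟩
        k ∘ (a ∘ F₁ G (ext a f))        ≈⟨ extendʳ k-hom ⟩
        a′ ∘ (F₁ G k ∘ F₁ G (ext a f))  ≈⟨ ∘-resp-≈ʳ G.homomorphism ⟨
        a′ ∘ F₁ G (k ∘ ext a f)         ∎

  ext-functor : ∀ {X Y A} (a : F₀ G A ⇒ A) (h : Y ⇒ A) (f : X ⇒ Y) → ext a h ∘ F₁ T f ≈ ext a (h ∘ f)
  ext-functor a h f = Equiv.trans (ext-fusion (ext-φ a h)) (ext-cong Equiv.refl (pullˡ (ext-η a h)))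

  ♯-functor : ∀ {X A} (a : F₀ G A ⇒ A) (f : X ⇒ A) → a ♯ ∘ F₁ T f ≈ ext a f
  ♯-functor a f = Equiv.trans (ext-functor a id f) (ext-cong Equiv.refl identityˡ)

  -- Both composites are the algebra homomorphism out of the free algebra on `Ĝ₀ X` that extends
  -- `k`.
  μ-natural : ∀ {X A} {a : F₀ G A ⇒ A} {k : Ĝ₀ X ⇒ A} → k ∘ φ X ≈ a ∘ F₁ G k → k ∘ μ X ≈ a ♯ ∘ F₁ T k
  μ-natural {a = a} {k} k-hom =
    Equiv.trans (ext-fusion k-hom) (Equiv.trans (ext-cong Equiv.refl identityʳ) (Equiv.sym (♯-functor a k)))

  -- The map `φ ∘ F₁ G η` is the universal transformation κ. Since `φ` factors as `μ ∘ κ`,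
  -- compatibility with `μ` can be turned into compatibility with `φ`.
  φ-from-μ : ∀ X → μ X ∘ (φ (Ĝ₀ X) ∘ F₁ G (η (Ĝ₀ X))) ≈ φ X
  φ-from-μ X = begin
    μ X ∘ (φ (Ĝ₀ X) ∘ F₁ G (η (Ĝ₀ X)))      ≈⟨ extendʳ (ext-φ (φ X) id) ⟩
    φ X ∘ (F₁ G (μ X) ∘ F₁ G (η (Ĝ₀ X)))    ≈⟨ elimʳ (Equiv.trans (F-fuse (ext-η (φ X) id)) G.identity) ⟩
    φ X                                     ∎

  ext-φ-η : ∀ {X A} (a : F₀ G A ⇒ A) (f : X ⇒ A) → ext a f ∘ (φ X ∘ F₁ G (η X)) ≈ a ∘ F₁ G f
  ext-φ-η {X} a f = begin
    ext a f ∘ (φ X ∘ F₁ G (η X))          ≈⟨ extendʳ (ext-φ a f) ⟩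
    a ∘ (F₁ G (ext a f) ∘ F₁ G (η X))     ≈⟨ ∘-resp-≈ʳ (F-fuse (ext-η a f)) ⟩
    a ∘ F₁ G f                            ∎

  ♯-φ-η : ∀ {A} (a : F₀ G A ⇒ A) → a ♯ ∘ (φ A ∘ F₁ G (η A)) ≈ a
  ♯-φ-η a = Equiv.trans (ext-φ-η a id) (elimʳ G.identity)

  -- Primitive recursion on a free algebra

  module Paramorphism (P : BinaryProducts 𝒜) {X B : Obj} where
    open BinaryProducts P
    open ProductProperties P

    private
      -- Primitive recursion becomes plain iteration once the second component rebuilds the term
      -- being consumed.
      pairing : F₀ G (B ×ₒ Ĝ₀ X) ⇒ B → F₀ G (B ×ₒ Ĝ₀ X) ⇒ B ×ₒ Ĝ₀ X
      pairing t = ⟨ t , φ X ∘ F₁ G π₂ ⟩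

      fold : F₀ G (B ×ₒ Ĝ₀ X) ⇒ B → X ⇒ B → Ĝ₀ X ⇒ B ×ₒ Ĝ₀ X
      fold t r = ext (pairing t) ⟨ r , η X ⟩

      -- The second projection is an algebra homomorphism from `pairing t` to `φ X`, so the
      -- composite is an endomorphism of the free algebra that fixes the generators.
      π₂∘fold : ∀ t r → π₂ ∘ fold t r ≈ id
      π₂∘fold t r = begin
        π₂ ∘ fold t r               ≈⟨ ext-fusion project₂ ⟩
        ext (φ X) (π₂ ∘ ⟨ r , η X ⟩)  ≈⟨ ext-unique
                                          (Equiv.trans identityˡ (Equiv.sym (elimʳ G.identity)))
                                          (Equiv.trans identityˡ (Equiv.sym project₂)) ⟩
        id                          ∎

    para : F₀ G (B ×ₒ Ĝ₀ X) ⇒ B → X ⇒ B → Ĝ₀ X ⇒ B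
    para t r = π₁ ∘ fold t r

    para-φ : ∀ t r → para t r ∘ φ X ≈ t ∘ F₁ G ⟨ para t r , id ⟩
    para-φ t r = begin
      para t r ∘ φ X                         ≈⟨ pullʳ (ext-φ _ _) ⟩
      π₁ ∘ (pairing t ∘ F₁ G (fold t r))     ≈⟨ pullˡ project₁ ⟩
      t ∘ F₁ G (fold t r)                    ≈⟨ ∘-resp-≈ʳ (G.F-resp-≈ (unique Equiv.refl (π₂∘fold t r))) ⟨
      t ∘ F₁ G ⟨ para t r , id ⟩             ∎

    para-η : ∀ t r → para t r ∘ η X ≈ r
    para-η t r = Equiv.trans (pullʳ (ext-η _ _)) project₁

    -- The recursion equation for `p` says that `⟨ p , id ⟩` is an algebra homomorphism into
    -- `pairing t`, and freeness determines it.
    para-unique : ∀ {t r} {p : Ĝ₀ X ⇒ B} → p ∘ φ X ≈ t ∘ F₁ G ⟨ p , id ⟩ → p ∘ η X ≈ r → para t r ≈ p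
    para-unique {t} {r} {p} p-φ p-η =
      Equiv.trans (∘-resp-≈ʳ (ext-unique pair-φ (Equiv.trans ⟨⟩∘ (⟨⟩-cong p-η identityˡ)))) project₁
      where
        pair-φ : ⟨ p , id ⟩ ∘ φ X ≈ pairing t ∘ F₁ G ⟨ p , id ⟩
        pair-φ = begin
          ⟨ p , id ⟩ ∘ φ X
            ≈⟨ ⟨⟩∘ ⟩
          ⟨ p ∘ φ X , id ∘ φ X ⟩
            ≈⟨ ⟨⟩-cong p-φ (Equiv.trans identityˡ (Equiv.sym φ∘Gπ₂)) ⟩
          ⟨ t ∘ F₁ G ⟨ p , id ⟩ , (φ X ∘ F₁ G π₂) ∘ F₁ G ⟨ p , id ⟩ ⟩
            ≈⟨ ⟨⟩∘ ⟨
          pairing t ∘ F₁ G ⟨ p , id ⟩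
            ∎
          where
            φ∘Gπ₂ : (φ X ∘ F₁ G π₂) ∘ F₁ G ⟨ p , id ⟩ ≈ φ X
            φ∘Gπ₂ = Equiv.trans (pullʳ (F-fuse project₂)) (elimʳ G.identity)

-- Bialgebras for a GSOS rule

module GSOSProperties {o m q : Level} {𝒜 : Category o m q} (P : BinaryProducts 𝒜) {H G : Endofunctor 𝒜}
                      (Ĝ : FreeAlgebras G) (ℓ : GSOSRule P H G Ĝ) where
  open Category 𝒜
  open HomReasoning
  open BinaryProducts P
  open CategoryProperties 𝒜
  open ProductProperties P
  open FreeAlgebras Ĝ renaming (Ĝ to Ĝ₀)
  open FreeAlgebraProperties Ĝ
  open Paramorphism P
  private
    module G = Endofunctor G
    module H = Endofunctor H
    module Gᶠ = FunctorProperties G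
    module Hᶠ = FunctorProperties H
    T = functor

  ℓ-natural : ∀ {X Y} (f : X ⇒ Y) → component ℓ Y ∘ F₁ G (F₁ H f ×₁ f) ≈ F₁ H (F₁ T f) ∘ component ℓ X
  ℓ-natural = NaturalTransformation.commute ℓ

  -- At the terminal coalgebra, with `x = c`, this is literally `IsInterpretation`, so `lift-hom`
  -- applies to interpretations directly.
  IsBialgebra : ∀ {A} → F₀ G A ⇒ A → A ⇒ F₀ H A → Set q
  IsBialgebra {A} a x = x ∘ a ≈ F₁ H (a ♯) ∘ component ℓ A ∘ F₁ G ⟨ x , id ⟩

  -- The rule needs each argument together with its behaviour, hence a paramorphism. It returns
  -- terms over terms, which `μ` flattens.
  lift : ∀ {Y} → Y ⇒ F₀ H (Ĝ₀ Y) → Ĝ₀ Y ⇒ F₀ H (Ĝ₀ Y)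
  lift {Y} g = para (F₁ H (μ Y) ∘ component ℓ (Ĝ₀ Y)) g

  lift-η : ∀ {Y} (g : Y ⇒ F₀ H (Ĝ₀ Y)) → lift g ∘ η Y ≈ g
  lift-η g = para-η _ g

  lift-bialgebra : ∀ {Y} (g : Y ⇒ F₀ H (Ĝ₀ Y)) → IsBialgebra (φ Y) (lift g)
  lift-bialgebra g = Equiv.trans (para-φ _ g) assoc

  -- Both sides are the paramorphism with step H(a♯) ∘ ℓ ∘ G(id × ext a f).
  lift-hom : ∀ {Y A} {a : F₀ G A ⇒ A} {x : A ⇒ F₀ H A} → IsBialgebra a x →
             {g : Y ⇒ F₀ H (Ĝ₀ Y)} {f : Y ⇒ A} → x ∘ f ≈ F₁ H (ext a f) ∘ g →
             x ∘ ext a f ≈ F₁ H (ext a f) ∘ lift g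
  lift-hom {Y} {A} {a} {x} bialg {g} {f} x∘f =
    Equiv.trans (Equiv.sym (para-unique x∘k-φ (pullʳ (ext-η a f))))
                (para-unique Hk∘ĝ-φ (Equiv.trans (pullʳ (lift-η g)) (Equiv.sym x∘f)))
    where
      k : Ĝ₀ Y ⇒ A
      k = ext a f

      ĝ : Ĝ₀ Y ⇒ F₀ H (Ĝ₀ Y)
      ĝ = lift g

      step : F₀ G (F₀ H A ×ₒ Ĝ₀ Y) ⇒ F₀ H A
      step = F₁ H (a ♯) ∘ (component ℓ A ∘ F₁ G (id ×₁ k))

      step-⟨⟩ : (p : Ĝ₀ Y ⇒ F₀ H A) → step ∘ F₁ G ⟨ p , id ⟩ ≈ F₁ H (a ♯) ∘ (component ℓ A ∘ F₁ G ⟨ p , k ⟩)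
      step-⟨⟩ p = pullʳ (pullʳ (Gᶠ.F-fuse (Equiv.trans ×₁∘⟨⟩ (⟨⟩-cong identityˡ identityʳ))))

      x∘k-φ : (x ∘ k) ∘ φ Y ≈ step ∘ F₁ G ⟨ x ∘ k , id ⟩
      x∘k-φ = begin
        (x ∘ k) ∘ φ Y
          ≈⟨ pullʳ (ext-φ a f) ⟩
        x ∘ (a ∘ F₁ G k)
          ≈⟨ pullˡ bialg ⟩
        (F₁ H (a ♯) ∘ (component ℓ A ∘ F₁ G ⟨ x , id ⟩)) ∘ F₁ G k
          ≈⟨ pullʳ (pullʳ (Gᶠ.F-fuse (Equiv.trans ⟨⟩∘ (⟨⟩-cong Equiv.refl identityˡ)))) ⟩
        F₁ H (a ♯) ∘ (component ℓ A ∘ F₁ G ⟨ x ∘ k , k ⟩)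
          ≈⟨ step-⟨⟩ (x ∘ k) ⟨
        step ∘ F₁ G ⟨ x ∘ k , id ⟩
          ∎

      Hk∘ĝ-φ : (F₁ H k ∘ ĝ) ∘ φ Y ≈ step ∘ F₁ G ⟨ F₁ H k ∘ ĝ , id ⟩
      Hk∘ĝ-φ = begin
        (F₁ H k ∘ ĝ) ∘ φ Y
          ≈⟨ pullʳ (lift-bialgebra g) ⟩
        F₁ H k ∘ (F₁ H (μ Y) ∘ (component ℓ (Ĝ₀ Y) ∘ F₁ G ⟨ ĝ , id ⟩))
          ≈⟨ extendʳ (Hᶠ.F-square (μ-natural (ext-φ a f))) ⟩
        F₁ H (a ♯) ∘ (F₁ H (F₁ T k) ∘ (component ℓ (Ĝ₀ Y) ∘ F₁ G ⟨ ĝ , id ⟩))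
          ≈⟨ ∘-resp-≈ʳ (extendʳ (Equiv.sym (ℓ-natural k))) ⟩
        F₁ H (a ♯) ∘ (component ℓ A ∘ (F₁ G (F₁ H k ×₁ k) ∘ F₁ G ⟨ ĝ , id ⟩))
          ≈⟨ ∘-resp-≈ʳ (∘-resp-≈ʳ (Gᶠ.F-fuse (Equiv.trans ×₁∘⟨⟩ (⟨⟩-cong Equiv.refl identityʳ)))) ⟩
        F₁ H (a ♯) ∘ (component ℓ A ∘ F₁ G ⟨ F₁ H k ∘ ĝ , k ⟩)
          ≈⟨ step-⟨⟩ (F₁ H k ∘ ĝ) ⟨
        step ∘ F₁ G ⟨ F₁ H k ∘ ĝ , id ⟩
          ∎

  -- This is `lift-hom` for the bialgebra on `Ĝ₀ Y` itself, with the identity as the map on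
  -- generators.
  lift-μ : ∀ {Y} (g : Y ⇒ F₀ H (Ĝ₀ Y)) → lift g ∘ μ Y ≈ F₁ H (μ Y) ∘ lift (F₁ H (η (Ĝ₀ Y)) ∘ lift g)
  lift-μ {Y} g = lift-hom (lift-bialgebra g) (begin
    lift g ∘ id                                     ≈⟨ identityʳ ⟩
    lift g                                          ≈⟨ identityˡ ⟨
    id ∘ lift g                                     ≈⟨ pullˡ (Equiv.trans (Hᶠ.F-fuse (ext-η (φ Y) id)) H.identity) ⟨
    F₁ H (μ Y) ∘ (F₁ H (η (Ĝ₀ Y)) ∘ lift g)         ∎)

  -- Existence and uniqueness of the interpretation

  module Interpretation (TC : TerminalCoalgebra H) where
    open TerminalCoalgebra TC

    coalgebra-hom-unique : ∀ {X} (x : X ⇒ F₀ H X) {f g : X ⇒ C} →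
                           c ∘ f ≈ F₁ H f ∘ x → c ∘ g ≈ F₁ H g ∘ x → f ≈ g
    coalgebra-hom-unique x p r = Equiv.trans (Equiv.sym (unique-hom p)) (unique-hom r)
      where
        unique-hom = proj₂ (proj₂ (terminal x))

    coalgebra-endo-id : ∀ {f : C ⇒ C} → c ∘ f ≈ F₁ H f ∘ c → f ≈ id
    coalgebra-endo-id p =
      coalgebra-hom-unique c p (Equiv.trans identityʳ (Equiv.sym (Equiv.trans (∘-resp-≈ˡ H.identity) identityˡ)))

    hom-∘ : ∀ {X Y} {x : X ⇒ F₀ H X} {y : Y ⇒ F₀ H Y} {f : Y ⇒ C} {k : X ⇒ Y} →
            c ∘ f ≈ F₁ H f ∘ y → y ∘ k ≈ F₁ H k ∘ x → c ∘ (f ∘ k) ≈ F₁ H (f ∘ k) ∘ x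
    hom-∘ {x = x} {y} {f} {k} f-hom k-hom = begin
      c ∘ (f ∘ k)               ≈⟨ extendʳ f-hom ⟩
      F₁ H f ∘ (y ∘ k)          ≈⟨ ∘-resp-≈ʳ k-hom ⟩
      F₁ H f ∘ (F₁ H k ∘ x)     ≈⟨ pullˡ (Equiv.sym H.homomorphism) ⟩
      F₁ H (f ∘ k) ∘ x          ∎

    -- The extension of `c` to terms over `C`, chosen so that `η C` is a coalgebra homomorphism from
    -- `c`.
    ĉ : Ĝ₀ C ⇒ F₀ H (Ĝ₀ C)
    ĉ = lift (F₁ H (η C) ∘ c)

    α : Ĝ₀ C ⇒ C
    α = proj₁ (terminal ĉ)

    α-hom : c ∘ α ≈ F₁ H α ∘ ĉ
    α-hom = proj₁ (proj₂ (terminal ĉ))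

    α-η : α ∘ η C ≈ id
    α-η = coalgebra-endo-id (hom-∘ α-hom (lift-η _))

    -- The `G`-algebra obtained by restricting `α` along κ. The laws `α-η` and `α-μ` make `α` an
    -- Eilenberg-Moore algebra for the free monad.
    interpretation : F₀ G C ⇒ C
    interpretation = α ∘ (φ C ∘ F₁ G (η C))

    -- Both sides are coalgebra homomorphisms into `C` from the same coalgebra on `Ĝ₀ (Ĝ₀ C)`, so
    -- terminality identifies them.
    α-μ : α ∘ μ C ≈ α ∘ F₁ T α
    α-μ = coalgebra-hom-unique (lift (F₁ H (η (Ĝ₀ C)) ∘ ĉ)) (hom-∘ α-hom (lift-μ _)) (hom-∘ α-hom Tα-hom)
      where
        Tα-hom : ĉ ∘ F₁ T α ≈ F₁ H (F₁ T α) ∘ lift (F₁ H (η (Ĝ₀ C)) ∘ ĉ)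
        Tα-hom = lift-hom (lift-bialgebra _) (begin
          ĉ ∘ (η C ∘ α)                               ≈⟨ pullˡ (lift-η _) ⟩
          (F₁ H (η C) ∘ c) ∘ α                        ≈⟨ pullʳ α-hom ⟩
          F₁ H (η C) ∘ (F₁ H α ∘ ĉ)                   ≈⟨ extendʳ (Hᶠ.F-square (Equiv.sym (ext-η (φ C) (η C ∘ α)))) ⟩
          F₁ H (F₁ T α) ∘ (F₁ H (η (Ĝ₀ C)) ∘ ĉ)       ∎)

    α-φ : α ∘ φ C ≈ interpretation ∘ F₁ G α
    α-φ = begin
      α ∘ φ C                                            ≈⟨ ∘-resp-≈ʳ (φ-from-μ C) ⟨
      α ∘ (μ C ∘ (φ (Ĝ₀ C) ∘ F₁ G (η (Ĝ₀ C))))           ≈⟨ extendʳ α-μ ⟩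
      α ∘ (F₁ T α ∘ (φ (Ĝ₀ C) ∘ F₁ G (η (Ĝ₀ C))))        ≈⟨ ∘-resp-≈ʳ (ext-φ-η (φ C) (η C ∘ α)) ⟩
      α ∘ (φ C ∘ F₁ G (η C ∘ α))                         ≈⟨ ∘-resp-≈ʳ (pullʳ (Equiv.sym G.homomorphism)) ⟨
      α ∘ ((φ C ∘ F₁ G (η C)) ∘ F₁ G α)                  ≈⟨ assoc ⟨
      interpretation ∘ F₁ G α                            ∎

    interpretation-♯ : interpretation ♯ ≈ α
    interpretation-♯ = ext-unique α-φ α-η

    interpretation-isInterpretation : IsInterpretation P TC Ĝ ℓ interpretation
    interpretation-isInterpretation = begin
      c ∘ (α ∘ (φ C ∘ F₁ G (η C)))
        ≈⟨ extendʳ α-hom ⟩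
      F₁ H α ∘ (ĉ ∘ (φ C ∘ F₁ G (η C)))
        ≈⟨ ∘-resp-≈ʳ (pullˡ (lift-bialgebra _)) ⟩
      F₁ H α ∘ ((F₁ H (μ C) ∘ (component ℓ (Ĝ₀ C) ∘ F₁ G ⟨ ĉ , id ⟩)) ∘ F₁ G (η C))
        -- On generators `ĉ` acts as `c`, which exposes an instance of naturality of the rule at
        -- `η C`.
        ≈⟨ ∘-resp-≈ʳ (pullʳ (pullʳ (Gᶠ.F-square ⟨ĉ,id⟩∘η))) ⟩
      F₁ H α ∘ (F₁ H (μ C) ∘ (component ℓ (Ĝ₀ C) ∘ (F₁ G (F₁ H (η C) ×₁ η C) ∘ F₁ G ⟨ c , id ⟩)))
        ≈⟨ ∘-resp-≈ʳ (∘-resp-≈ʳ (extendʳ (ℓ-natural (η C)))) ⟩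
      F₁ H α ∘ (F₁ H (μ C) ∘ (F₁ H (F₁ T (η C)) ∘ (component ℓ C ∘ F₁ G ⟨ c , id ⟩)))
        -- The flattening cancels against `η` by the unit law of the monad.
        ≈⟨ ∘-resp-≈ʳ (Equiv.trans (pullˡ (Equiv.trans (Hᶠ.F-fuse μ∘Tη) H.identity)) identityˡ) ⟩
      F₁ H α ∘ (component ℓ C ∘ F₁ G ⟨ c , id ⟩)
        ≈⟨ ∘-resp-≈ˡ (H.F-resp-≈ interpretation-♯) ⟨
      F₁ H (interpretation ♯) ∘ (component ℓ C ∘ F₁ G ⟨ c , id ⟩)
        ∎
      where
        ⟨ĉ,id⟩∘η : ⟨ ĉ , id ⟩ ∘ η C ≈ (F₁ H (η C) ×₁ η C) ∘ ⟨ c , id ⟩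
        ⟨ĉ,id⟩∘η = Equiv.trans ⟨⟩∘ (Equiv.trans
          (⟨⟩-cong (lift-η _) (Equiv.trans identityˡ (Equiv.sym identityʳ))) (Equiv.sym ×₁∘⟨⟩))

        μ∘Tη : μ C ∘ F₁ T (η C) ≈ id
        μ∘Tη = Equiv.trans (♯-functor (φ C) (η C)) (ext-unique
          (Equiv.trans identityˡ (Equiv.sym (elimʳ G.identity))) identityˡ)

    -- For any interpretation `b`, `b ♯` is a coalgebra homomorphism from `ĉ`, hence equals `α`;
    -- restriction along κ recovers `b`.
    interpretation-unique : ∀ {b : F₀ G C ⇒ C} → IsInterpretation P TC Ĝ ℓ b → interpretation ≈ b
    interpretation-unique {b} b-int = Equiv.trans (∘-resp-≈ˡ α≈b♯) (♯-φ-η b)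
      where
        α≈b♯ : α ≈ b ♯
        α≈b♯ = coalgebra-hom-unique ĉ α-hom (lift-hom b-int (begin
          c ∘ id                              ≈⟨ identityʳ ⟩
          c                                   ≈⟨ identityˡ ⟨
          id ∘ c                              ≈⟨ pullˡ (Equiv.trans (Hᶠ.F-fuse (ext-η b id)) H.identity) ⟨
          F₁ H (b ♯) ∘ (F₁ H (η C) ∘ c)       ∎))

    -- Corecursion and complete iterativity for an interpretation

    module _ {b : F₀ G C ⇒ C} (b-int : IsInterpretation P TC Ĝ ℓ b) where

      -- A converse to `lift-hom`: coalgebra homomorphisms into `C` are automatically algebra
      -- homomorphisms. Terminality gives compatibility with `μ`, and restriction along κ gives
      -- compatibility with `φ`.
      coalgebra-hom-is-ext : ∀ {Y} {g : Y ⇒ F₀ H (Ĝ₀ Y)} {β : Ĝ₀ Y ⇒ C} →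
                             c ∘ β ≈ F₁ H β ∘ lift g → ext b (β ∘ η Y) ≈ β
      coalgebra-hom-is-ext {Y} {g} {β} β-hom = ext-unique β-φ Equiv.refl
        where
          β-μ : β ∘ μ Y ≈ ext b β
          β-μ = coalgebra-hom-unique (lift (F₁ H (η (Ĝ₀ Y)) ∘ lift g)) (hom-∘ β-hom (lift-μ g)) (lift-hom b-int (begin
            c ∘ β                                           ≈⟨ β-hom ⟩
            F₁ H β ∘ lift g                                 ≈⟨ pullˡ (Hᶠ.F-fuse (ext-η b β)) ⟨
            F₁ H (ext b β) ∘ (F₁ H (η (Ĝ₀ Y)) ∘ lift g)     ∎))

          β-φ : β ∘ φ Y ≈ b ∘ F₁ G β
          β-φ = begin
            β ∘ φ Y                                         ≈⟨ ∘-resp-≈ʳ (φ-from-μ Y) ⟨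
            β ∘ (μ Y ∘ (φ (Ĝ₀ Y) ∘ F₁ G (η (Ĝ₀ Y))))        ≈⟨ pullˡ β-μ ⟩
            ext b β ∘ (φ (Ĝ₀ Y) ∘ F₁ G (η (Ĝ₀ Y)))          ≈⟨ ext-φ-η b β ⟩
            b ∘ F₁ G β                                      ∎

      -- Solutions `h` and coalgebra homomorphisms `β` from `lift g` determine each other through
      -- `ext b h` and `β ∘ η Y`.
      corecursion : ∀ {Y} (g : Y ⇒ F₀ H (Ĝ₀ Y)) → ∃! _≈_ (λ (h : Y ⇒ C) → c ∘ h ≈ F₁ H (ext b h) ∘ g)
      corecursion {Y} g = β ∘ η Y , c∘h , λ {h} h-sol → begin
          β ∘ η Y          ≈⟨ ∘-resp-≈ˡ (coalgebra-hom-unique (lift g) β-hom (lift-hom b-int h-sol)) ⟩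
          ext b h ∘ η Y    ≈⟨ ext-η b h ⟩
          h                ∎
        where
          β : Ĝ₀ Y ⇒ C
          β = proj₁ (terminal (lift g))

          β-hom : c ∘ β ≈ F₁ H β ∘ lift g
          β-hom = proj₁ (proj₂ (terminal (lift g)))

          c∘h : c ∘ (β ∘ η Y) ≈ F₁ H (ext b (β ∘ η Y)) ∘ g
          c∘h = begin
            c ∘ (β ∘ η Y)                   ≈⟨ extendʳ β-hom ⟩
            F₁ H β ∘ (lift g ∘ η Y)         ≈⟨ ∘-resp-≈ (H.F-resp-≈ (Equiv.sym (coalgebra-hom-is-ext β-hom))) (lift-η g) ⟩
            F₁ H (ext b (β ∘ η Y)) ∘ g      ∎

      completelyIterative : (S : BinaryCoproducts 𝒜) → IsCompletelyIterative S (H ∘F functor) (c⁻¹ ∘ F₁ H (b ♯))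
      completelyIterative S {X} e = h ∘ i₁ , e†-solves , unique-e†
        where
          open BinaryCoproducts S
          open CoproductProperties S

          Solves : X ⇒ C → Set q
          Solves f = f ≈ [ c⁻¹ ∘ F₁ H (b ♯) , id ] ∘ (F₁ (H ∘F functor) f +₁ id) ∘ e

          -- Parameters unfold as in `c` and stay in the right summand, which forces every
          -- corecursive solution to be the identity there.
          g₂ : C ⇒ F₀ H (Ĝ₀ (X +ₒ C))
          g₂ = F₁ H (η (X +ₒ C) ∘ i₂) ∘ c

          -- When `e` yields a parameter instead of a guarded term, it is unfolded once through
          -- `g₂`.
          g₁ : X ⇒ F₀ H (Ĝ₀ (X +ₒ C))
          g₁ = [ F₁ H (F₁ T i₁) , g₂ ] ∘ e

          g : X +ₒ C ⇒ F₀ H (Ĝ₀ (X +ₒ C))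
          g = [ g₁ , g₂ ]

          Hext∘g₂ : (k : X +ₒ C ⇒ C) → F₁ H (ext b k) ∘ g₂ ≈ F₁ H (k ∘ i₂) ∘ c
          Hext∘g₂ k = pullˡ (Hᶠ.F-fuse (pullˡ (ext-η b k)))

          Hext∘g₁ : {k : X +ₒ C ⇒ C} → k ∘ i₂ ≈ id → F₁ H (ext b k) ∘ g₁ ≈ [ F₁ H (ext b (k ∘ i₁)) , c ] ∘ e
          Hext∘g₁ {k} k∘i₂ = pullˡ (Equiv.trans ∘[] ([]-cong (Hᶠ.F-fuse (ext-functor b k i₁)) (begin
            F₁ H (ext b k) ∘ g₂        ≈⟨ Hext∘g₂ k ⟩
            F₁ H (k ∘ i₂) ∘ c          ≈⟨ ∘-resp-≈ˡ (Equiv.trans (H.F-resp-≈ k∘i₂) H.identity) ⟩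
            id ∘ c                     ≈⟨ identityˡ ⟩
            c                          ∎)))

          -- Writing `id` as `c⁻¹ ∘ c` on the parameters extracts `c⁻¹` from both cases. Cancelling
          -- it leaves the left component of the corecursion equation for `g`.
          rhs : (f : X ⇒ C) →
                [ c⁻¹ ∘ F₁ H (b ♯) , id ] ∘ ((F₁ (H ∘F functor) f +₁ id) ∘ e) ≈ c⁻¹ ∘ ([ F₁ H (ext b f) , c ] ∘ e)
          rhs f = begin
            [ c⁻¹ ∘ F₁ H (b ♯) , id ] ∘ ((F₁ H (F₁ T f) +₁ id) ∘ e)
              ≈⟨ pullˡ []∘+₁ ⟩
            [ (c⁻¹ ∘ F₁ H (b ♯)) ∘ F₁ H (F₁ T f) , id ∘ id ] ∘ e
              ≈⟨ ∘-resp-≈ˡ ([]-cong (pullʳ (Hᶠ.F-fuse (♯-functor b f))) (Equiv.trans identityˡ (Equiv.sym c⁻¹∘c≈id))) ⟩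
            [ c⁻¹ ∘ F₁ H (ext b f) , c⁻¹ ∘ c ] ∘ e
              ≈⟨ pullˡ ∘[] ⟨
            c⁻¹ ∘ ([ F₁ H (ext b f) , c ] ∘ e)
              ∎

          h : X +ₒ C ⇒ C
          h = proj₁ (corecursion g)

          c∘h : c ∘ h ≈ F₁ H (ext b h) ∘ g
          c∘h = proj₁ (proj₂ (corecursion g))

          h∘i₂ : h ∘ i₂ ≈ id
          h∘i₂ = coalgebra-endo-id (begin
            c ∘ (h ∘ i₂)                    ≈⟨ extendʳ c∘h ⟩
            F₁ H (ext b h) ∘ (g ∘ i₂)       ≈⟨ ∘-resp-≈ʳ inject₂ ⟩
            F₁ H (ext b h) ∘ g₂             ≈⟨ Hext∘g₂ h ⟩
            F₁ H (h ∘ i₂) ∘ c               ∎)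

          e†-solves : Solves (h ∘ i₁)
          e†-solves = begin
            h ∘ i₁                                          ≈⟨ identityˡ ⟨
            id ∘ (h ∘ i₁)                                   ≈⟨ pullˡ c⁻¹∘c≈id ⟨
            c⁻¹ ∘ (c ∘ (h ∘ i₁))                            ≈⟨ ∘-resp-≈ʳ (extendʳ c∘h) ⟩
            c⁻¹ ∘ (F₁ H (ext b h) ∘ (g ∘ i₁))               ≈⟨ ∘-resp-≈ʳ (∘-resp-≈ʳ inject₁) ⟩
            c⁻¹ ∘ (F₁ H (ext b h) ∘ g₁)                     ≈⟨ ∘-resp-≈ʳ (Hext∘g₁ h∘i₂) ⟩
            c⁻¹ ∘ ([ F₁ H (ext b (h ∘ i₁)) , c ] ∘ e)       ≈⟨ rhs (h ∘ i₁) ⟨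
            [ c⁻¹ ∘ F₁ H (b ♯) , id ] ∘ (F₁ (H ∘F functor) (h ∘ i₁) +₁ id) ∘ e ∎

          unique-e† : ∀ {f} → Solves f → h ∘ i₁ ≈ f
          unique-e† {f} f-solves =
            Equiv.trans (∘-resp-≈ˡ (proj₂ (proj₂ (corecursion g)) (jointly-epic on-i₁ on-i₂))) inject₁
            where
              -- Extended by the identity on parameters, a solution `f` becomes a corecursive
              -- solution for `g`, hence equals `h`.
              k : X +ₒ C ⇒ C
              k = [ f , id ]

              on-i₁ : (c ∘ k) ∘ i₁ ≈ (F₁ H (ext b k) ∘ g) ∘ i₁
              on-i₁ = begin
                (c ∘ k) ∘ i₁                                   ≈⟨ pullʳ inject₁ ⟩
                c ∘ f                                          ≈⟨ ∘-resp-≈ʳ (Equiv.trans f-solves (rhs f)) ⟩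
                c ∘ (c⁻¹ ∘ ([ F₁ H (ext b f) , c ] ∘ e))       ≈⟨ Equiv.trans (pullˡ c∘c⁻¹≈id) identityˡ ⟩
                [ F₁ H (ext b f) , c ] ∘ e                     ≈⟨ ∘-resp-≈ˡ ([]-cong (H.F-resp-≈ (ext-cong Equiv.refl inject₁)) Equiv.refl) ⟨
                [ F₁ H (ext b (k ∘ i₁)) , c ] ∘ e              ≈⟨ Hext∘g₁ inject₂ ⟨
                F₁ H (ext b k) ∘ g₁                            ≈⟨ pullʳ inject₁ ⟨
                (F₁ H (ext b k) ∘ g) ∘ i₁                      ∎

              on-i₂ : (c ∘ k) ∘ i₂ ≈ (F₁ H (ext b k) ∘ g) ∘ i₂
              on-i₂ = begin
                (c ∘ k) ∘ i₂                   ≈⟨ pullʳ inject₂ ⟩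
                c ∘ id                         ≈⟨ identityʳ ⟩
                c                              ≈⟨ identityˡ ⟨
                id ∘ c                         ≈⟨ ∘-resp-≈ˡ (Equiv.trans (H.F-resp-≈ inject₂) H.identity) ⟨
                F₁ H (k ∘ i₂) ∘ c              ≈⟨ Hext∘g₂ k ⟨
                F₁ H (ext b k) ∘ g₂            ≈⟨ pullʳ inject₂ ⟨
                (F₁ H (ext b k) ∘ g) ∘ i₂      ∎

-- Combining the rule and the scheme into one rule

module CombinedRule {o m q : Level} {𝒜 : Category o m q} (P : BinaryProducts 𝒜) (S : BinaryCoproducts 𝒜)
                    {H : Endofunctor 𝒜} (TC : TerminalCoalgebra H) {K V : Endofunctor 𝒜}
                    (K̂ : FreeAlgebras K) (F̂ : FreeAlgebras (coproductFunctor S K V))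
                    (ℓ : GSOSRule P H K K̂) (e : RPS P S H K V F̂) where
  open Category 𝒜
  open HomReasoning
  open BinaryProducts P
  open BinaryCoproducts S
  open CategoryProperties 𝒜
  open CoproductProperties S
  open TerminalCoalgebra TC
  private
    F = coproductFunctor S K V
    module H = Endofunctor H
    module Hᶠ = FunctorProperties H
    module K̂ = FreeAlgebras K̂
    module F̂ = FreeAlgebras F̂
    module K̂ᵖ = FreeAlgebraProperties K̂
    module F̂ᵖ = FreeAlgebraProperties F̂

  -- The monad morphism induced by the coproduct injection of `K` into `K + V`.
  inclusion : ∀ X → K̂.Ĝ X ⇒ F̂.Ĝ X
  inclusion X = K̂.ext (F̂.φ X ∘ i₁) (F̂.η X)

  restrict-hom : ∀ {A B} {a : F₀ F A ⇒ A} {a′ : F₀ F B ⇒ B} {k : A ⇒ B} →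
                 k ∘ a ≈ a′ ∘ F₁ F k → k ∘ (a ∘ i₁) ≈ (a′ ∘ i₁) ∘ F₁ K k
  restrict-hom {a = a} {a′} {k} k-hom = begin
    k ∘ (a ∘ i₁)               ≈⟨ extendʳ k-hom ⟩
    a′ ∘ (F₁ F k ∘ i₁)         ≈⟨ ∘-resp-≈ʳ inject₁ ⟩
    a′ ∘ (i₁ ∘ F₁ K k)         ≈⟨ assoc ⟨
    (a′ ∘ i₁) ∘ F₁ K k         ∎

  -- An `F`-homomorphism restricts to a `K`-homomorphism, so both sides are the `K`-homomorphism
  -- extending `f`.
  ext-inclusion : ∀ {X A} (a : F₀ F A ⇒ A) (f : X ⇒ A) → F̂.ext a f ∘ inclusion X ≈ K̂.ext (a ∘ i₁) f
  ext-inclusion a f = Equiv.trans (K̂ᵖ.ext-fusion (restrict-hom (F̂.ext-φ a f))) (K̂ᵖ.ext-cong Equiv.refl (F̂.ext-η a f))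

  inclusion-natural : ∀ {X Y} (f : X ⇒ Y) → inclusion Y ∘ F₁ K̂.functor f ≈ F₁ F̂.functor f ∘ inclusion X
  inclusion-natural {X} {Y} f = begin
    inclusion Y ∘ F₁ K̂.functor f                    ≈⟨ K̂ᵖ.ext-functor _ _ f ⟩
    K̂.ext (F̂.φ Y ∘ i₁) (F̂.η Y ∘ f)                  ≈⟨ ext-inclusion (F̂.φ Y) (F̂.η Y ∘ f) ⟨
    F₁ F̂.functor f ∘ inclusion X                    ∎

  combined : GSOSRule P H F F̂
  combined = record
    { component = λ X → [ F₁ H (inclusion X) ∘ component ℓ X , component e X ]
    ; commute = λ {X} {Y} f → begin
        [ F₁ H (inclusion Y) ∘ component ℓ Y , component e Y ] ∘ (F₁ K (F₁ H f ×₁ f) +₁ F₁ V (F₁ H f ×₁ f))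
          ≈⟨ []∘+₁ ⟩
        [ (F₁ H (inclusion Y) ∘ component ℓ Y) ∘ F₁ K (F₁ H f ×₁ f) , component e Y ∘ F₁ V (F₁ H f ×₁ f) ]
          ≈⟨ []-cong (Equiv.trans (pullʳ (NaturalTransformation.commute ℓ f)) (extendʳ (Hᶠ.F-square (inclusion-natural f))))
                     (NaturalTransformation.commute e f) ⟩
        [ F₁ H (F₁ F̂.functor f) ∘ (F₁ H (inclusion X) ∘ component ℓ X) , F₁ H (F₁ F̂.functor f) ∘ component e X ]
          ≈⟨ ∘[] ⟨
        F₁ H (F₁ F̂.functor f) ∘ [ F₁ H (inclusion X) ∘ component ℓ X , component e X ]
          ∎
    }

  -- Keeping `d` apart from `s` lets the equation be stated for `d ∘ i₂` before `d` is known to be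
  -- `[ b , s ]`.
  IsSolution : F₀ F C ⇒ C → F₀ V C ⇒ C → Set q
  IsSolution d s = s ≈ c⁻¹ ∘ F₁ H (d F̂.♯) ∘ component e C ∘ F₁ V ⟨ c , id ⟩

  -- Precomposing `d ♯` with `inclusion` sees only the `K`-part of `d`, so the left component is the
  -- right-hand side of the interpretation equation for `ℓ` alone.
  combined-split : (d : F₀ F C ⇒ C) →
    F₁ H (d F̂.♯) ∘ (component combined C ∘ F₁ F ⟨ c , id ⟩) ≈
    [ F₁ H ((d ∘ i₁) K̂.♯) ∘ (component ℓ C ∘ F₁ K ⟨ c , id ⟩) , F₁ H (d F̂.♯) ∘ (component e C ∘ F₁ V ⟨ c , id ⟩) ]
  combined-split d = begin
    F₁ H (d F̂.♯) ∘ (component combined C ∘ F₁ F ⟨ c , id ⟩)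
      ≈⟨ ∘-resp-≈ʳ []∘+₁ ⟩
    F₁ H (d F̂.♯) ∘ [ (F₁ H (inclusion C) ∘ component ℓ C) ∘ F₁ K ⟨ c , id ⟩ , component e C ∘ F₁ V ⟨ c , id ⟩ ]
      ≈⟨ ∘[] ⟩
    [ F₁ H (d F̂.♯) ∘ ((F₁ H (inclusion C) ∘ component ℓ C) ∘ F₁ K ⟨ c , id ⟩) , _ ]
      ≈⟨ []-cong (Equiv.trans (∘-resp-≈ʳ assoc) (pullˡ (Hᶠ.F-fuse (ext-inclusion d id)))) Equiv.refl ⟩
    [ F₁ H ((d ∘ i₁) K̂.♯) ∘ (component ℓ C ∘ F₁ K ⟨ c , id ⟩) , F₁ H (d F̂.♯) ∘ (component e C ∘ F₁ V ⟨ c , id ⟩) ]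
      ∎

  interpretation-i₁ : ∀ {d} → IsInterpretation P TC F̂ combined d → IsInterpretation P TC K̂ ℓ (d ∘ i₁)
  interpretation-i₁ {d} d-int = Equiv.trans (pullˡ (Equiv.trans d-int (combined-split d))) inject₁

  interpretation-i₂ : ∀ {d} → IsInterpretation P TC F̂ combined d → IsSolution d (d ∘ i₂)
  interpretation-i₂ {d} d-int = begin
    d ∘ i₂                 ≈⟨ identityˡ ⟨
    id ∘ (d ∘ i₂)          ≈⟨ pullˡ c⁻¹∘c≈id ⟨
    c⁻¹ ∘ (c ∘ (d ∘ i₂))   ≈⟨ ∘-resp-≈ʳ (Equiv.trans (pullˡ (Equiv.trans d-int (combined-split d))) inject₂) ⟩
    c⁻¹ ∘ (F₁ H (d F̂.♯) ∘ (component e C ∘ F₁ V ⟨ c , id ⟩)) ∎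

  interpretation-[] : ∀ {b s} → IsInterpretation P TC K̂ ℓ b → IsSolution [ b , s ] s →
                      IsInterpretation P TC F̂ combined [ b , s ]
  interpretation-[] {b} {s} b-int s-sol = begin
    c ∘ [ b , s ]
      ≈⟨ ∘[] ⟩
    [ c ∘ b , c ∘ s ]
      ≈⟨ []-cong (Equiv.trans b-int (∘-resp-≈ˡ (H.F-resp-≈ (K̂ᵖ.ext-cong (Equiv.sym inject₁) Equiv.refl))))
                 (Equiv.trans (∘-resp-≈ʳ s-sol) (Equiv.trans (pullˡ c∘c⁻¹≈id) identityˡ)) ⟩
    [ F₁ H (([ b , s ] ∘ i₁) K̂.♯) ∘ (component ℓ C ∘ F₁ K ⟨ c , id ⟩) , _ ]
      ≈⟨ combined-split [ b , s ] ⟨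
    F₁ H ([ b , s ] F̂.♯) ∘ (component combined C ∘ F₁ F ⟨ c , id ⟩)
      ∎

mainTheorem10 : ∀ {o m q : Level} (𝒜 : Category o m q) (P : BinaryProducts 𝒜) (S : BinaryCoproducts 𝒜)
    (H : Endofunctor 𝒜) (T : TerminalCoalgebra H)
    (K V : Endofunctor 𝒜) (K̂ : FreeAlgebras K) (F̂ : FreeAlgebras (coproductFunctor S K V))
    (let open Category 𝒜)
    (let open BinaryProducts P)
    (let open BinaryCoproducts S)
    (let open TerminalCoalgebra T)
    (let open FreeAlgebras F̂)
    (ℓ : GSOSRule P H K K̂) (b : F₀ K C ⇒ C) → IsInterpretation P T K̂ ℓ b →
    (e : RPS P S H K V F̂) →
    Σ (∃! _≈_ (λ (s : F₀ V C ⇒ C) → s ≈ c⁻¹ ∘ F₁ H ([ b , s ] ♯) ∘ component e C ∘ F₁ V ⟨ c , id ⟩))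
    (λ sol → let s = proj₁ sol in
    IsCompletelyIterative S (H ∘F FreeAlgebras.functor F̂) (c⁻¹ ∘ F₁ H ([ b , s ] ♯)))
mainTheorem10 𝒜 P S H T K V K̂ F̂ ℓ b b-int e =
  -- Any solution `s′` makes `[ b , s′ ]` an interpretation of the combined rule, hence equal to
  -- `d`; its right component is then `s`.
  (s , s-solves , λ {s′} s′-solves →
    Equiv.trans (∘-resp-≈ˡ (ᶠ.interpretation-unique (interpretation-[] b-int s′-solves))) inject₂) ,
  ᶠ.completelyIterative (interpretation-[] b-int s-solves) S
  where
    open Category 𝒜
    open BinaryCoproducts S
    open TerminalCoalgebra T
    open CombinedRule P S T K̂ F̂ ℓ e
    module ᵏ = GSOSProperties.Interpretation P K̂ ℓ T
    module ᶠ = GSOSProperties.Interpretation P F̂ combined T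

    d : F₀ (coproductFunctor S K V) C ⇒ C
    d = ᶠ.interpretation

    s : F₀ V C ⇒ C
    s = d ∘ i₂

    d-int : IsInterpretation P T F̂ combined d
    d-int = ᶠ.interpretation-isInterpretation

    -- The left component of `d` interprets `ℓ`, as does `b`, so uniqueness of interpretations for
    -- `ℓ` identifies them.
    d≈[b,s] : d ≈ [ b , s ]
    d≈[b,s] = Equiv.sym (unique
      (Equiv.trans (Equiv.sym (ᵏ.interpretation-unique (interpretation-i₁ d-int))) (ᵏ.interpretation-unique b-int))
      Equiv.refl)

    s-solves : IsSolution [ b , s ] s
    s-solves = Equiv.trans (interpretation-i₂ d-int)
      (∘-resp-≈ʳ (∘-resp-≈ˡ (Endofunctor.F-resp-≈ H (FreeAlgebraProperties.ext-cong F̂ d≈[b,s] Equiv.refl))))
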